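{- The m-SPLIT COLLISION problem reduces to the multilinear identity testing problem (MIT) for additive subgroups of black-box rings. That is, from an instance $f:[k]\to[k]$ (given as an oracle, with $m\mid k$) of m-SPLIT COLLISION one can construct an instance of MIT for additive subgroups, consisting of a finite black-box ring $R$, an additive subgroup $T=\langle T_1,\dots,T_k\rangle$ of $R$ given by generators, and a multilinear polynomial $P(x_1,\dots,x_m)$ over $R$, such that $P=0$ is an identity for $T$ if and only if $f$ has no $m$-split collision.
   Context: Notation: $[k]=\{1,\dots,k\}$. m-SPLIT COLLISION: given a positive integer $m$ and a function $f:[k]\to[k]$ as an oracle, where $k=nm$, divide $\{1,\dots,k\}$ into $m$ intervals $I_1,\dots,I_m$, each containing $n$ consecutive points of $[k]$. The function $f$ has an $m$-split collision if for some $j\in[k]$ we have $|f^{ -1}(j)|=m$ and $|f^{ -1}(j)\cap I_i|=1$ for each $i=1,\dots,m$. The problem is to decide whether $f$ has an $m$-split collision. MIT for additive subgroups of black-box rings: given a finite black-box ring $R$ (elements encoded by binary strings, addition and multiplication performed by oracles), elements $T_1,\dots,T_k\in R$ generating an additive subgroup $T=\langle T_1,\dots,T_k\rangle=\{\sum_i\alpha_iT_i\mid\alpha_i\in\mathbb{Z}\}$, and a multilinear polynomial $P(x_1,\dots,x_m)$ over $R$ given as a black-box $P:R^m\to R$, decide whether $P=0$ is an identity for $T$, i.e. whether $P(a_1,\dots,a_m)=0$ for all $a_1,\dots,a_m\in T$. Here the indeterminates may be noncommuting, coefficients from $R$ may occur on both sides of a product of indeterminates, and multilinear means that each indeterminate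 occurs with degree at most one in each monomial. -}

module Defs where

open import Level using (0ℓ)
open import Algebra.Bundles using (Ring)
open import Data.Bool.Base using (Bool)
open import Data.Nat.Base using (ℕ; suc; _*_)
open import Data.Integer.Base using (ℤ; +_; -[1+_])
open import Data.Fin.Base using (Fin; quotient)
open import Data.Fin.Properties using (_≟_)
open import Data.Fin.Subset using (Subset; ∣_∣; _∩_)
open import Data.List.Base using (List; []; _∷_; foldl; map)
open import Data.List.Relation.Unary.Unique.Propositional using (Unique)
open import Data.Product.Base using (Σ-syntax; ∃-syntax; _×_; _,_; proj₁; proj₂)
open import Data.Vec.Base as Vec using (Vec; lookup; tabulate)
open import Function.Bundles using (Injection; Inverse)
open import Relation.Binary.PropositionalEquality using (_≡_; setoid)
open import Relation.Nullary.Decidable using (does)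
import Algebra.Definitions.RawMonoid as RawMonoidDefinitions

------------------------------------------------------------------------
-- Split collisions

-- [k] is Fin (m * n); quotient n cuts it into m blocks of n consecutive
-- points, block i being { n·i , … , n·i + (n-1) }.

interval : ∀ m n → Fin m → Subset (m * n)
interval m n i = tabulate λ x → does (quotient {m} n x ≟ i)

preimage : ∀ {k} → (Fin k → Fin k) → Fin k → Subset k
preimage f j = tabulate λ x → does (f x ≟ j)

HasSplitCollision : ∀ m n → (Fin (m * n) → Fin (m * n)) → Set
HasSplitCollision m n f =
  ∃[ j ] (∣ preimage f j ∣ ≡ m
          × (∀ i → ∣ preimage f j ∩ interval m n i ∣ ≡ 1))

------------------------------------------------------------------------
-- Multilinear polynomials over a ring, and additive subgroups

module _ (R : Ring 0ℓ 0ℓ) where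
  open Ring R renaming (_*_ to _·_)
  open RawMonoidDefinitions +-rawMonoid using (sum) renaming (_×_ to _×ℕ_)

  -- (c₀ , (i₁ , c₁) ∷ … ∷ (iᵣ , cᵣ) ∷ []) stands for the monomial
  -- c₀ x_{i₁} c₁ x_{i₂} ⋯ x_{iᵣ} cᵣ in noncommuting indeterminates.

  Monomial : ℕ → Set
  Monomial m = Carrier × List (Fin m × Carrier)

  record MultilinearMonomial (m : ℕ) : Set where
    field
      monomial    : Monomial m
      multilinear : Unique (map proj₁ (proj₂ monomial))

  MultilinearPolynomial : ℕ → Set
  MultilinearPolynomial m = List (MultilinearMonomial m)

  evalMonomial : ∀ {m} → Monomial m → Vec Carrier m → Carrier
  evalMonomial (c , xs) a =
    foldl (λ acc (i , d) → acc · lookup a i · d) c xs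

  evalPolynomial : ∀ {m} → MultilinearPolynomial m → Vec Carrier m → Carrier
  evalPolynomial []      a = 0#
  evalPolynomial (t ∷ p) a =
    evalMonomial (MultilinearMonomial.monomial t) a + evalPolynomial p a

  _×ℤ_ : ℤ → Carrier → Carrier
  (+ a)    ×ℤ x = a ×ℕ x
  -[1+ a ] ×ℤ x = - (suc a ×ℕ x)

  InAdditiveSpan : ∀ {k} → (Fin k → Carrier) → Carrier → Set
  InAdditiveSpan {k} T x =
    Σ[ α ∈ (Fin k → ℤ) ] x ≈ sum (λ i → α i ×ℤ T i)

------------------------------------------------------------------------
-- Black-box rings and instances of identity testing

Word : ℕ → Set
Word ℓ = Vec Bool ℓ

-- Each element has exactly one encoding, but not every word need encode an
-- element; the oracles are unconstrained on words that do not.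

record BlackBoxRing (ℓ : ℕ) : Set₁ where
  field
    ring     : Ring 0ℓ 0ℓ
    size     : ℕ
    finite   : Inverse (Ring.setoid ring) (setoid (Fin size))
    encoding : Injection (Ring.setoid ring) (setoid (Word ℓ))

  open Ring ring public using (Carrier; _≈_; _+_; 0#) renaming (_*_ to _·_)

  encode : Carrier → Word ℓ
  encode = Injection.to encoding

  field
    addOracle         : Word ℓ → Word ℓ → Word ℓ
    addOracle-correct : ∀ x y → addOracle (encode x) (encode y) ≡ encode (x + y)
    mulOracle         : Word ℓ → Word ℓ → Word ℓ
    mulOracle-correct : ∀ x y → mulOracle (encode x) (encode y) ≡ encode (x · y)

-- The formal polynomial only certifies that the function polyOracle is one.

record MITInstance (m k ℓ : ℕ) : Set₁ where
  field
    blackBoxRing : BlackBoxRing ℓ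

  open BlackBoxRing blackBoxRing public

  field
    generator          : Fin k → Carrier
    polynomial         : MultilinearPolynomial ring m
    polyOracle         : Vec (Word ℓ) m → Word ℓ
    polyOracle-correct : ∀ a → polyOracle (Vec.map encode a)
                               ≡ encode (evalPolynomial ring polynomial a)

  IsIdentity : Set
  IsIdentity = ∀ a → (∀ i → InAdditiveSpan ring generator (lookup a i)) →
               evalPolynomial ring polynomial a ≈ 0#

------------------------------------------------------------------------
-- Computing with an oracle f : [k] → [k]

-- Decision trees making at most q queries on every path.

data OracleProc (k : ℕ) (A : Set) : ℕ → Set where
  return : ∀ {q} → A → OracleProc k A q
  query  : ∀ {q} → Fin k → (Fin k → OracleProc k A q) → OracleProc k A (suc q)

run : ∀ {k A q} → OracleProc k A q → (Fin k → Fin k) → A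
run (return x)  f = x
run (query i c) f = run (c (f i)) f

-- The output of an oracle construction: each access to the constructed
-- instance (ring operation, generator, polynomial) is answered by a
-- procedure that sees f only through at most q queries.

record Procedures (m k ℓ q : ℕ) : Set where
  field
    addProc       : Word ℓ → Word ℓ → OracleProc k (Word ℓ) q
    mulProc       : Word ℓ → Word ℓ → OracleProc k (Word ℓ) q
    generatorProc : Fin k → OracleProc k (Word ℓ) q
    polyProc      : Vec (Word ℓ) m → OracleProc k (Word ℓ) q

record Implements {m k ℓ q : ℕ} (procs : Procedures m k ℓ q)
                  (f : Fin k → Fin k) (I : MITInstance m k ℓ) : Set where
  open Procedures procs
  open MITInstance I
  field
    add-answers       : ∀ u v → run (addProc u v) f ≡ addOracle u v
    mul-answers       : ∀ u v → run (mulProc u v) f ≡ mulOracle u v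
    generator-answers : ∀ i → run (generatorProc i) f ≡ encode (generator i)
    poly-answers      : ∀ us → run (polyProc us) f ≡ polyOracle us

{-# OPTIONS --safe #-}

-- In the product over j ∈ [k] of the matrix rings M_m(F₂), let T_x, for x in
-- the block Iᵢ, have as j-th component the matrix unit Eᵢᵢ if f takes the value
-- j exactly once on Iᵢ, and 0 otherwise.  With J the all-ones matrix and Dₜ the
-- matrix whose row t is all ones and whose other rows vanish, every matrix A
-- satisfies J A Dₜ = s J, where s is the sum of column t of A.  Hence
-- P = J x₁ D₁ x₂ D₂ ⋯ xₘ Dₘ evaluates to the product of the t-th column sums of
-- the xₜ, times J.  In component j, some choice of xₜ ∈ T makes this product
-- nonzero iff for every t some generator has a nonzero t-th column, that is, iff
-- j has exactly one preimage in every block.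

module Submission where

open import Defs
open import Level using (0ℓ)
open import Algebra.Bundles using (CommutativeMonoid; Ring; CommutativeRing)
import Algebra.Construct.Pointwise as Pointwise
import Algebra.Properties.CommutativeMonoid.Sum as MonoidSum
import Algebra.Properties.Semiring.Sum as SemiringSum
open import Data.Bool.Base using (Bool; true; false; T; _∧_; _xor_; if_then_else_)
open import Data.Bool.ListAction using (all)
import Data.Bool.Properties as Bool
open import Data.Bool.Properties
  using (xor-∧-commutativeRing; ∧-assoc; ∧-identityʳ; ∧-zeroʳ; T-≡; ¬-not)
open import Data.Fin.Base
  using (Fin; zero; suc; combine; remQuot; quotient; remainder; punchIn; fromℕ<;
         funToFin; finToFun; _↑ˡ_; _↑ʳ_)
open import Data.Fin.Properties
  using (_≟_; ¬∀⟶∃¬; punchInᵢ≢i; remQuot-combine; combine-remQuot; 2↔Bool;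
         funToFin-finToFin; finToFun-funToFin)
open import Data.Fin.Subset using (Subset; ∣_∣; _∩_)
open import Data.Integer.Base using (ℤ; +_; -[1+_])
open import Data.List.Base as List using (List; []; _∷_; allFin)
open import Data.List.Membership.Propositional.Properties using (∈-allFin)
import Data.List.Properties as List
import Data.List.Relation.Unary.All as All
open import Data.List.Relation.Unary.All.Properties using (all⁺; all⁻)
open import Data.List.Relation.Unary.Unique.Propositional using (Unique)
open import Data.List.Relation.Unary.Unique.Propositional.Properties using (allFin⁺)
open import Data.Nat.Base using (ℕ; zero; suc; NonZero; _*_; _^_; >-nonZero⁻¹)
import Data.Nat.Base as ℕ
import Data.Nat.Properties as ℕ
open import Data.Product.Base using (Σ-syntax; ∃-syntax; _×_; _,_; proj₁; proj₂)
open import Data.Vec.Base as Vec using (Vec; []; _∷_; lookup; tabulate; count)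
import Data.Vec.Properties as Vec
open import Data.Vec.Functional using (Vector; removeAt)
open import Function.Base using (_∘_)
open import Function.Bundles using (_⇔_; mk⇔; Inverse; Equivalence)
import Function.Construct.Composition as Compose
open import Function.Properties.Inverse using (Inverse⇒Injection)
open import Relation.Binary.Bundles using (Setoid)
open import Relation.Binary.PropositionalEquality
  using (_≡_; _≢_; refl; sym; trans; cong; cong₂; subst; setoid; module ≡-Reasoning)
open import Relation.Nullary using (¬_; does; yes; no; contradiction)
open import Relation.Nullary.Decidable using (dec-true; dec-false)
open import Relation.Unary using (Pred; Decidable)

-- Finite sums in commutative monoids.

module _ {c ℓ} (M : CommutativeMonoid c ℓ) where
  open CommutativeMonoid M hiding (refl; sym; trans) renaming (_∙_ to _+_; ε to 0#)
  open MonoidSum M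
  open import Relation.Binary.Reasoning.Setoid (CommutativeMonoid.setoid M)

  sum-zero : ∀ {n} (t : Vector Carrier n) → (∀ i → t i ≈ 0#) → sum t ≈ 0#
  sum-zero {n} t t≈0 = CommutativeMonoid.trans M (sum-cong-≋ t≈0) (sum-replicate-zero n)

  sum-single : ∀ {n} (t : Vector Carrier n) i → (∀ j → j ≢ i → t j ≈ 0#) → sum t ≈ t i
  sum-single {suc n} t i t≈0 = begin
    sum t                     ≈⟨ sum-remove t ⟩
    t i + sum (removeAt t i)  ≈⟨ ∙-congˡ (sum-zero _ λ j → t≈0 (punchIn i j) (punchInᵢ≢i i j)) ⟩
    t i + 0#                  ≈⟨ identityʳ (t i) ⟩
    t i                       ∎

  sum-++ : ∀ m {n} (t : Vector Carrier (m ℕ.+ n)) →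
           sum t ≈ sum (t ∘ (_↑ˡ n)) + sum (t ∘ (m ↑ʳ_))
  sum-++ zero    t = CommutativeMonoid.sym M (identityˡ _)
  sum-++ (suc m) t =
    CommutativeMonoid.trans M (∙-congˡ (sum-++ m (t ∘ suc)))
      (CommutativeMonoid.sym M (assoc _ _ _))

  -- `combine` lists block 0 first and shifts every later block by n, so induction on m peels off
  -- one block at a time.
  sum-combine : ∀ m {n} (t : Vector Carrier (m * n)) →
                sum t ≈ sum (λ (i : Fin m) → sum (λ (y : Fin n) → t (combine i y)))
  sum-combine zero        t = CommutativeMonoid.refl M
  sum-combine (suc m) {n} t =
    CommutativeMonoid.trans M (sum-++ n t) (∙-congˡ (sum-combine m (t ∘ (n ↑ʳ_))))

-- Matrix rings and powers of rings.

module _ {c ℓ} (R : Ring c ℓ) (n : ℕ) where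
  open Ring R hiding (refl; sym; trans; zero) renaming (_*_ to _·_)
  open SemiringSum semiring
  open import Relation.Binary.Reasoning.Setoid (Ring.setoid R)

  private
    Matrix = Fin n → Fin n → Carrier

    identity : Matrix
    identity p q = if does (p ≟ q) then 1# else 0#

    _⊗_ : Matrix → Matrix → Matrix
    (a ⊗ b) p r = ∑[ q < n ] (a p q · b q r)

    identity-diagonal : ∀ p → identity p p ≡ 1#
    identity-diagonal p rewrite dec-true (p ≟ p) refl = refl

    identity-off-diagonal : ∀ {p q} → p ≢ q → identity p q ≡ 0#
    identity-off-diagonal {p} {q} p≢q rewrite dec-false (p ≟ q) p≢q = refl

    ⊗-identityˡ : ∀ a p r → (identity ⊗ a) p r ≈ a p r
    ⊗-identityˡ a p r = begin
      (identity ⊗ a) p r      ≈⟨ sum-single +-commutativeMonoid _ p (λ q q≢p →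
                                   Ring.trans R (*-congʳ (reflexive (identity-off-diagonal (q≢p ∘ sym))))
                                     (zeroˡ _)) ⟩
      identity p p · a p r    ≡⟨ cong (_· a p r) (identity-diagonal p) ⟩
      1# · a p r              ≈⟨ *-identityˡ _ ⟩
      a p r                   ∎

    ⊗-identityʳ : ∀ a p r → (a ⊗ identity) p r ≈ a p r
    ⊗-identityʳ a p r = begin
      (a ⊗ identity) p r      ≈⟨ sum-single +-commutativeMonoid _ r (λ q q≢r →
                                   Ring.trans R (*-congˡ (reflexive (identity-off-diagonal q≢r)))
                                     (zeroʳ _)) ⟩
      a p r · identity r r    ≡⟨ cong (a p r ·_) (identity-diagonal r) ⟩
      a p r · 1#              ≈⟨ *-identityʳ _ ⟩
      a p r                   ∎

    -- Both sides expand to the same double sum over q and r, taken in opposite orders.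
    ⊗-assoc : ∀ a b d p s → ((a ⊗ b) ⊗ d) p s ≈ (a ⊗ (b ⊗ d)) p s
    ⊗-assoc a b d p s = begin
      ∑[ r < n ] (∑[ q < n ] (a p q · b q r) · d r s)
        ≈⟨ sum-cong-≋ {n} (λ r → *-distribʳ-sum (d r s) (λ q → a p q · b q r)) ⟩
      ∑[ r < n ] ∑[ q < n ] (a p q · b q r · d r s)
        ≈⟨ ∑-comm (λ r q → a p q · b q r · d r s) ⟩
      ∑[ q < n ] ∑[ r < n ] (a p q · b q r · d r s)
        ≈⟨ sum-cong-≋ {n} (λ q → sum-cong-≋ {n} λ r → *-assoc (a p q) (b q r) (d r s)) ⟩
      ∑[ q < n ] ∑[ r < n ] (a p q · (b q r · d r s))
        ≈⟨ sum-cong-≋ {n} (λ q → *-distribˡ-sum (a p q) (λ r → b q r · d r s)) ⟨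
      ∑[ q < n ] (a p q · ∑[ r < n ] (b q r · d r s))
        ∎

    ⊗-distribˡ : ∀ a b d p r → (a ⊗ (λ q s → b q s + d q s)) p r ≈ (a ⊗ b) p r + (a ⊗ d) p r
    ⊗-distribˡ a b d p r = begin
      ∑[ q < n ] (a p q · (b q r + d q r))          ≈⟨ sum-cong-≋ {n} (λ q → distribˡ (a p q) (b q r) (d q r)) ⟩
      ∑[ q < n ] (a p q · b q r + a p q · d q r)    ≈⟨ ∑-distrib-+ (λ q → a p q · b q r) _ ⟩
      (a ⊗ b) p r + (a ⊗ d) p r                     ∎

    ⊗-distribʳ : ∀ a b d p r → ((λ q s → b q s + d q s) ⊗ a) p r ≈ (b ⊗ a) p r + (d ⊗ a) p r
    ⊗-distribʳ a b d p r = begin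
      ∑[ q < n ] ((b p q + d p q) · a q r)          ≈⟨ sum-cong-≋ {n} (λ q → distribʳ (a q r) (b p q) (d p q)) ⟩
      ∑[ q < n ] (b p q · a q r + d p q · a q r)    ≈⟨ ∑-distrib-+ (λ q → b p q · a q r) _ ⟩
      (b ⊗ a) p r + (d ⊗ a) p r                     ∎

  matrixRing : Ring c ℓ
  matrixRing = record
    { Carrier = Matrix
    ; _≈_     = λ a b → ∀ p q → a p q ≈ b p q
    ; _+_     = λ a b p q → a p q + b p q
    ; _*_     = _⊗_
    ; -_      = λ a p q → - a p q
    ; 0#      = λ _ _ → 0#
    ; 1#      = identity
    ; isRing  = record
      { +-isAbelianGroup = Pointwise.isAbelianGroup _ (Pointwise.isAbelianGroup _ +-isAbelianGroup)
      ; *-cong           = λ a≈b d≈e p r → sum-cong-≋ λ q → *-cong (a≈b p q) (d≈e q r)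
      ; *-assoc          = ⊗-assoc
      ; *-identity       = ⊗-identityˡ , ⊗-identityʳ
      ; distrib          = ⊗-distribˡ , ⊗-distribʳ
      }
    }

powerRing : ∀ {c ℓ} → Set → Ring c ℓ → Ring c ℓ
powerRing A R = record { isRing = Pointwise.isRing A (Ring.isRing R) }

-- Evaluation of polynomials, and additive spans.

module _ (R : Ring 0ℓ 0ℓ) where
  open Ring R hiding (refl; sym; trans; zero) renaming (_*_ to _·_)
  open MonoidSum +-commutativeMonoid

  evalMonomial-cong : ∀ {m} (t : Monomial R m) {a b : Vec Carrier m} →
                      (∀ i → lookup a i ≈ lookup b i) →
                      evalMonomial R t a ≈ evalMonomial R t b
  evalMonomial-cong {m} (c , xs) {a} {b} a≈b = go xs {c} {c} (Ring.refl R)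
    where
    -- The accumulators must be allowed to differ, because `foldl` absorbs the substituted values
    -- into them.
    go : ∀ xs {c d} → c ≈ d → evalMonomial R (c , xs) a ≈ evalMonomial R (d , xs) b
    go []             c≈d = c≈d
    go ((i , e) ∷ xs) c≈d = go xs (*-congʳ (*-cong c≈d (a≈b i)))

  evalPolynomial-cong : ∀ {m} (p : MultilinearPolynomial R m) {a b : Vec Carrier m} →
                        (∀ i → lookup a i ≈ lookup b i) →
                        evalPolynomial R p a ≈ evalPolynomial R p b
  evalPolynomial-cong []      a≈b = Ring.refl R
  evalPolynomial-cong (t ∷ p) {a} {b} a≈b =
    +-cong (evalMonomial-cong (MultilinearMonomial.monomial t) {a} {b} a≈b)
           (evalPolynomial-cong p {a} {b} a≈b)

  generator∈span : ∀ {k} (g : Fin k → Carrier) x → InAdditiveSpan R g (g x)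
  generator∈span g x = α , Ring.sym R (Ring.trans R (sum-single +-commutativeMonoid _ x off) on)
    where
    α : Fin _ → ℤ
    α i = if does (i ≟ x) then + 1 else + 0
    off : ∀ i → i ≢ x → _×ℤ_ R (α i) (g i) ≈ 0#
    off i i≢x rewrite dec-false (i ≟ x) i≢x = Ring.refl R
    on : _×ℤ_ R (α x) (g x) ≈ g x
    on rewrite dec-true (x ≟ x) refl = +-identityʳ (g x)

  module _ (P : Carrier → Set)
           (P-resp : ∀ {x y} → x ≈ y → P x → P y)
           (P-0 : P 0#)
           (P-+ : ∀ {x y} → P x → P y → P (x + y))
           (P-neg : ∀ {x} → P x → P (- x)) where

    -- The closure conditions make `P` an additive subgroup, so it contains all integer combinations
    -- of its members.
    span-induction : ∀ {k} (g : Fin k → Carrier) → (∀ i → P (g i)) →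
                     ∀ {x} → InAdditiveSpan R g x → P x
    span-induction {k} g Pg (α , x≈) = P-resp (Ring.sym R x≈) (P-sum _ λ i → P-×ℤ (α i) (Pg i))
      where
      open import Algebra.Definitions.RawMonoid +-rawMonoid using () renaming (_×_ to _×ℕ_)
      P-×ℕ : ∀ n {x} → P x → P (n ×ℕ x)
      P-×ℕ zero    Px = P-0
      P-×ℕ (suc n) Px = P-+ Px (P-×ℕ n Px)
      P-×ℤ : ∀ z {x} → P x → P (_×ℤ_ R z x)
      P-×ℤ (+ n)    Px = P-×ℕ n Px
      P-×ℤ -[1+ n ] Px = P-neg (P-×ℕ (suc n) Px)
      P-sum : ∀ {n} (t : Fin n → Carrier) → (∀ i → P (t i)) → P (sum t)
      P-sum {zero}  t Pt = P-0
      P-sum {suc n} t Pt = P-+ (Pt zero) (P-sum (t ∘ suc) (Pt ∘ suc))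

-- Words as encodings, and black-box rings built from them.

module _ {A B : Setoid 0ℓ 0ℓ} where
  private
    module A = Setoid A
    module B = Setoid B

  mkInverse : (to : A.Carrier → B.Carrier) (from : B.Carrier → A.Carrier) →
              (∀ {x y} → x A.≈ y → to x B.≈ to y) → (∀ {x y} → x B.≈ y → from x A.≈ from y) →
              (∀ y → to (from y) B.≈ y) → (∀ x → from (to x) A.≈ x) → Inverse A B
  mkInverse to from to-cong from-cong to∘from from∘to = record
    { to        = to
    ; from      = from
    ; to-cong   = to-cong
    ; from-cong = from-cong
    ; inverse   = (λ eq → B.trans (to-cong eq) (to∘from _)) , λ eq → A.trans (from-cong eq) (from∘to _)
    }

-- Stands in for function extensionality: the digit functions compared in `word↔fin` agree only
-- pointwise.
funToFin-cong : ∀ {m n} {f g : Fin m → Fin n} → (∀ i → f i ≡ g i) → funToFin f ≡ funToFin g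
funToFin-cong {zero}  f≗g = refl
funToFin-cong {suc m} f≗g = cong₂ combine (f≗g zero) (funToFin-cong (f≗g ∘ suc))

word↔fin : ∀ ℓ → Inverse (setoid (Word ℓ)) (setoid (Fin (2 ^ ℓ)))
word↔fin ℓ = mkInverse to from (cong to) (cong from) to∘from from∘to
  where
  module Bit = Inverse 2↔Bool
  to : Word ℓ → Fin (2 ^ ℓ)
  to w = funToFin (Bit.from ∘ lookup w)
  from : Fin (2 ^ ℓ) → Word ℓ
  from z = tabulate (Bit.to ∘ finToFun z)
  to∘from : ∀ z → to (from z) ≡ z
  to∘from z = trans
    (funToFin-cong {ℓ} {2} {g = finToFun {2} {ℓ} z} λ i →
      trans (cong Bit.from (Vec.lookup∘tabulate (Bit.to ∘ finToFun z) i)) (Bit.inverseʳ refl))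
    (funToFin-finToFin {ℓ} {2} z)
  from∘to : ∀ w → from (to w) ≡ w
  from∘to w = trans
    (Vec.tabulate-cong λ i → trans (cong Bit.to (finToFun-funToFin _ i)) (Bit.inverseˡ refl))
    (Vec.tabulate∘lookup w)

module _ (R : Ring 0ℓ 0ℓ) {ℓ : ℕ} (I : Inverse (Ring.setoid R) (setoid (Word ℓ))) where
  open Ring R hiding (refl; sym; trans; zero) renaming (_*_ to _·_)
  open Inverse I renaming (to to encode; from to decode)

  private
    decode∘encode : ∀ x → decode (encode x) ≈ x
    decode∘encode x = inverseʳ refl

  -- Every word encodes an element here, so the ring has 2 ^ ℓ elements and the oracles may decode
  -- any input.
  blackBox : BlackBoxRing ℓ
  blackBox = record
    { ring              = R
    ; size              = 2 ^ ℓ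
    ; finite            = Compose.inverse I (word↔fin ℓ)
    ; encoding          = Inverse⇒Injection I
    ; addOracle         = λ u v → encode (decode u + decode v)
    ; addOracle-correct = λ x y → to-cong (+-cong (decode∘encode x) (decode∘encode y))
    ; mulOracle         = λ u v → encode (decode u · decode v)
    ; mulOracle-correct = λ x y → to-cong (*-cong (decode∘encode x) (decode∘encode y))
    }

  identityTesting : ∀ {m k} → (Fin k → Carrier) → MultilinearPolynomial R m → MITInstance m k ℓ
  identityTesting g p = record
    { blackBoxRing       = blackBox
    ; generator          = g
    ; polynomial         = p
    ; polyOracle         = λ us → encode (evalPolynomial R p (Vec.map decode us))
    ; polyOracle-correct = λ a → to-cong (evalPolynomial-cong R p λ i → Ring.trans R
        (reflexive (trans (Vec.lookup-map i decode (Vec.map encode a))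
                          (cong decode (Vec.lookup-map i encode a))))
        (decode∘encode (lookup a i)))
    }

-- Cardinalities as sums of indicators.

∧-falseʳ : ∀ x {y} → y ≡ false → x ∧ y ≡ false
∧-falseʳ x refl = ∧-zeroʳ x

∧-trueʳ : ∀ x {y} → y ≡ true → x ∧ y ≡ x
∧-trueʳ x refl = ∧-identityʳ x

module ℕSum = MonoidSum ℕ.+-0-commutativeMonoid

indicator : Bool → ℕ
indicator b = if b then 1 else 0

count-sum : ∀ {A : Set} {P : Pred A 0ℓ} (P? : Decidable P) {n} (xs : Vec A n) →
            count P? xs ≡ ℕSum.sum (λ i → indicator (does (P? (lookup xs i))))
count-sum P? []       = refl
count-sum P? (x ∷ xs) with does (P? x)
... | true  = cong suc (count-sum P? xs)
... | false = count-sum P? xs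

∣∣-sum : ∀ {n} (S : Subset n) → ∣ S ∣ ≡ ℕSum.sum (λ x → indicator (lookup S x))
∣∣-sum S = trans (count-sum _ S) (ℕSum.sum-cong-≗ λ x → cong indicator (does-≟-true (lookup S x)))
  where
  does-≟-true : ∀ b → does (b Bool.≟ true) ≡ b
  does-≟-true true  = refl
  does-≟-true false = refl

-- Split collisions in terms of multiplicities on blocks.

module _ {m n : ℕ} (f : Fin (m * n) → Fin (m * n)) where
  open ℕSum using (sum; sum-cong-≗)

  -- Kept as a vector of values because this is exactly what querying the points of a block yields.
  block : Fin m → Vec (Fin (m * n)) n
  block i = Vec.map f (tabulate (combine i))

  multiplicity : Fin (m * n) → Fin m → ℕ
  multiplicity j i = count (_≟ j) (block i)

  private
    hit : Fin (m * n) → Fin m → Fin n → Bool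
    hit j i y = does (f (combine i y) ≟ j)

    multiplicity-sum : ∀ j i → multiplicity j i ≡ sum (λ y → indicator (hit j i y))
    multiplicity-sum j i = trans (count-sum (_≟ j) (block i)) (sum-cong-≗ {n} λ y →
      cong (λ z → indicator (does (z ≟ j)))
        (trans (Vec.lookup-map y f (tabulate (combine i)))
               (cong f (Vec.lookup∘tabulate (combine i) y))))

  ∣preimage∣ : ∀ j → ∣ preimage f j ∣ ≡ sum (multiplicity j)
  ∣preimage∣ j = begin
    ∣ preimage f j ∣
      ≡⟨ ∣∣-sum (preimage f j) ⟩
    sum (λ x → indicator (lookup (preimage f j) x))
      ≡⟨ sum-cong-≗ {m * n} (λ x → cong indicator (Vec.lookup∘tabulate (λ x → does (f x ≟ j)) x)) ⟩
    sum (λ x → indicator (does (f x ≟ j)))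
      ≡⟨ sum-combine ℕ.+-0-commutativeMonoid m _ ⟩
    sum (λ i → sum (λ y → indicator (hit j i y)))
      ≡⟨ sum-cong-≗ (multiplicity-sum j) ⟨
    sum (multiplicity j)
      ∎
    where open ≡-Reasoning

  -- Once the sum is split into blocks, the factor for membership in the interval kills every block
  -- other than i.
  ∣preimage∩interval∣ : ∀ j i → ∣ preimage f j ∩ interval m n i ∣ ≡ multiplicity j i
  ∣preimage∩interval∣ j i = begin
    ∣ preimage f j ∩ interval m n i ∣
      ≡⟨ ∣∣-sum (preimage f j ∩ interval m n i) ⟩
    sum (λ x → indicator (lookup (preimage f j ∩ interval m n i) x))
      ≡⟨ sum-cong-≗ (λ x → cong indicator (trans
           (Vec.lookup-zipWith _∧_ x (preimage f j) (interval m n i))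
           (cong₂ _∧_ (Vec.lookup∘tabulate _ x) (Vec.lookup∘tabulate _ x)))) ⟩
    sum (λ x → indicator (does (f x ≟ j) ∧ does (quotient {m} n x ≟ i)))
      ≡⟨ sum-combine ℕ.+-0-commutativeMonoid m _ ⟩
    sum (λ i′ → sum (λ y → indicator (hit j i′ y ∧ does (quotient {m} n (combine i′ y) ≟ i))))
      ≡⟨ sum-cong-≗ (λ i′ → sum-cong-≗ {n} λ y →
           cong (λ q → indicator (hit j i′ y ∧ does (proj₁ q ≟ i))) (remQuot-combine i′ y)) ⟩
    sum (λ i′ → sum (λ y → indicator (hit j i′ y ∧ does (i′ ≟ i))))
      ≡⟨ sum-single ℕ.+-0-commutativeMonoid _ i (λ i′ i′≢i →
           sum-zero ℕ.+-0-commutativeMonoid {n} _ λ y → cong indicator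
             (∧-falseʳ (hit j i′ y) (dec-false (i′ ≟ i) i′≢i))) ⟩
    sum (λ y → indicator (hit j i y ∧ does (i ≟ i)))
      ≡⟨ sum-cong-≗ {n} (λ y → cong indicator (∧-trueʳ (hit j i y) (dec-true (i ≟ i) refl))) ⟩
    sum (λ y → indicator (hit j i y))
      ≡⟨ multiplicity-sum j i ⟨
    multiplicity j i
      ∎
    where open ≡-Reasoning

  -- The preimage of j has as many elements as its m multiplicities add up to, which is m when each
  -- of them is 1.
  splitCollision⇔ : HasSplitCollision m n f ⇔ (∃[ j ] (∀ i → multiplicity j i ≡ 1))
  splitCollision⇔ = mk⇔
    (λ (j , _ , once) → j , λ i → trans (sym (∣preimage∩interval∣ j i)) (once i))
    (λ (j , once) → j
      , trans (∣preimage∣ j) (trans (sum-cong-≗ once) (sum-ones m))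
      , λ i → trans (∣preimage∩interval∣ j i) (once i))
    where
    sum-ones : ∀ m → sum {m} (λ _ → 1) ≡ m
    sum-ones zero    = refl
    sum-ones (suc m) = cong suc (sum-ones m)

-- The ring and the polynomial.

𝔽₂ : Ring 0ℓ 0ℓ
𝔽₂ = CommutativeRing.ring xor-∧-commutativeRing

module 𝔽₂Sum = SemiringSum (Ring.semiring 𝔽₂)

module _ (m k : ℕ) where
  splitRing : Ring 0ℓ 0ℓ
  splitRing = powerRing (Fin k) (matrixRing 𝔽₂ m)

  open Ring splitRing using (Carrier) renaming (_*_ to _·_)
  open 𝔽₂Sum

  -- An element consists of k matrices with m * m bits each; position `combine j (combine p q)`
  -- holds entry (p, q) of component j.
  splitRing↔word : Inverse (Ring.setoid splitRing) (setoid (Word (k * (m * m))))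
  splitRing↔word = mkInverse
    (λ a → tabulate (entry a))
    (λ w j p q → lookup w (combine j (combine p q)))
    (λ {a} {b} a≈b → Vec.tabulate-cong λ z → a≈b _ _ _)
    (λ { refl _ _ _ → refl })
    (λ w → trans (Vec.tabulate-cong λ z → cong (lookup w) (trans
        (cong (combine (quotient {k} (m * m) z)) (combine-remQuot {m} m (remainder {k} (m * m) z)))
        (combine-remQuot {k} (m * m) z)))
      (Vec.tabulate∘lookup w))
    (λ a j p q → trans (Vec.lookup∘tabulate (entry a) _) (entry-combine a j p q))
    where
    entry : Carrier → Fin (k * (m * m)) → Bool
    entry a z = let j , pq = remQuot {k} (m * m) z ; p , q = remQuot {m} m pq in a j p q
    entry-combine : ∀ a j p q → entry a (combine j (combine p q)) ≡ a j p q
    entry-combine a j p q = trans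
      (cong (λ (i , rs) → let r , s = remQuot {m} m rs in a i r s) (remQuot-combine j (combine p q)))
      (cong (λ (r , s) → a j r s) (remQuot-combine p q))

  ones : Carrier
  ones _ _ _ = true

  -- Right multiplication by this Dₜ copies column t into every column.
  onesRow : Fin m → Carrier
  onesRow t _ p _ = does (p ≟ t)

  factors : List (Fin m) → List (Fin m × Carrier)
  factors = List.map λ t → t , onesRow t

  splitPolynomial : MultilinearPolynomial splitRing m
  splitPolynomial = record
    { monomial    = ones , factors (allFin m)
    -- The indeterminates read off `factors` are just `allFin m`, in which nothing repeats.
    ; multilinear = subst Unique
        (trans (sym (List.map-id (allFin m))) (List.map-∘ (allFin m)))
        (allFin⁺ m)
    } ∷ []

  columnSum : Carrier → Fin k → Fin m → Bool
  columnSum a j t = ∑[ p < m ] a j p t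

  module _ (a : Vec Carrier m) (j : Fin k) where
    -- The invariant is that component j of the accumulator equals l J. All rows of l J x are l
    -- times the column sums of x, and Dₜ then spreads the t-th of them over all columns.
    factor-step : ∀ t acc l → (∀ p q → acc j p q ≡ l) →
                  ∀ p q → ((acc · lookup a t) · onesRow t) j p q ≡ l ∧ columnSum (lookup a t) j t
    factor-step t acc l acc≡l p q = begin
      ∑[ r < m ] ((∑[ s < m ] (acc j p s ∧ x s r)) ∧ does (r ≟ t))
        ≡⟨ sum-single +-commutativeMonoid _ t (λ r r≢t →
             ∧-falseʳ (∑[ s < m ] (acc j p s ∧ x s r)) (dec-false (r ≟ t) r≢t)) ⟩
      (∑[ s < m ] (acc j p s ∧ x s t)) ∧ does (t ≟ t)
        ≡⟨ ∧-trueʳ (∑[ s < m ] (acc j p s ∧ x s t)) (dec-true (t ≟ t) refl) ⟩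
      ∑[ s < m ] (acc j p s ∧ x s t)
        ≡⟨ sum-cong-≗ (λ s → cong (_∧ x s t) (acc≡l p s)) ⟩
      ∑[ s < m ] (l ∧ x s t)
        ≡⟨ *-distribˡ-sum l (λ s → x s t) ⟨
      l ∧ columnSum (lookup a t) j t
        ∎
      where
      open ≡-Reasoning
      open Ring 𝔽₂ using (+-commutativeMonoid)
      x = lookup a t j

    -- Iterates `factor-step`; over `𝔽₂` the product of the column sums is their conjunction, whence
    -- `all`.
    evalFactors : ∀ ts acc l → (∀ p q → acc j p q ≡ l) → ∀ p q →
                  evalMonomial splitRing (acc , factors ts) a j p q
                    ≡ l ∧ all (λ t → columnSum (lookup a t) j t) ts
    evalFactors []       acc l acc≡l p q = trans (acc≡l p q) (sym (∧-identityʳ l))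
    evalFactors (t ∷ ts) acc l acc≡l p q =
      trans (evalFactors ts _ _ (factor-step t acc l acc≡l) p q) (∧-assoc l _ _)

    evalSplitPolynomial : ∀ p q → evalPolynomial splitRing splitPolynomial a j p q
                                  ≡ all (λ t → columnSum (lookup a t) j t) (allFin m)
    evalSplitPolynomial p q =
      trans (Ring.+-identityʳ 𝔽₂ _) (evalFactors (allFin m) ones true (λ _ _ → refl) p q)

  ZeroColumn : Fin k → Fin m → Carrier → Set
  ZeroColumn j t a = ∀ p → a j p t ≡ false

  -- The vanishing of a column is a linear condition, so it passes from the generators to all of T.
  span-zeroColumn : ∀ {l} j t (g : Fin l → Carrier) → (∀ x → ZeroColumn j t (g x)) →
                    ∀ {a} → InAdditiveSpan splitRing g a → ZeroColumn j t a
  span-zeroColumn j t = span-induction splitRing (ZeroColumn j t)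
    (λ a≈b a≡0 p → trans (sym (a≈b j p t)) (a≡0 p))
    (λ _ → refl)
    (λ a≡0 b≡0 p → cong₂ _xor_ (a≡0 p) (b≡0 p))
    -- Negation in `𝔽₂` is the identity.
    (λ a≡0 → a≡0)

  -- The generators and their columns.

  module _ {n : ℕ} where
    -- The argument `vs` holds the values of f on block i, so n queries settle all k components at
    -- once; points of the same block receive the same generator.
    blockElement : Fin m → Vec (Fin k) n → Carrier
    blockElement i vs j p q = does (p ≟ i) ∧ (does (q ≟ i) ∧ does (count (_≟ j) vs ℕ.≟ 1))

    columnSum-blockElement : ∀ i vs j → count (_≟ j) vs ≡ 1 → columnSum (blockElement i vs) j i ≡ true
    columnSum-blockElement i vs j once = trans
      (sum-single (Ring.+-commutativeMonoid 𝔽₂) _ i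
        λ p p≢i → cong (_∧ (does (i ≟ i) ∧ _)) (dec-false (p ≟ i) p≢i))
      (cong₂ _∧_ i≟i (cong₂ _∧_ i≟i (dec-true (count (_≟ j) vs ℕ.≟ 1) once)))
      where
      i≟i = dec-true (i ≟ i) refl

    -- Column i is the only one where Eᵢᵢ is nonzero; for t = i the hypothesis makes component j
    -- vanish altogether.
    blockElement-zeroColumn : ∀ i vs j t → (i ≡ t → count (_≟ j) vs ≢ 1) →
                              ZeroColumn j t (blockElement i vs)
    blockElement-zeroColumn i vs j t ≢1 p with t ≟ i
    ... | no  _    = ∧-zeroʳ _
    ... | yes refl = ∧-falseʳ (does (p ≟ i)) (dec-false (count (_≟ j) vs ℕ.≟ 1) (≢1 refl))

-- Answering oracle calls by queries to f.

queryAll : ∀ {k A n} → Vec (Fin k) n → (Vec (Fin k) n → A) → OracleProc k A n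
queryAll []       c = return (c [])
queryAll (x ∷ xs) c = query x λ y → queryAll xs (c ∘ (y ∷_))

run-queryAll : ∀ {k A n} (xs : Vec (Fin k) n) (c : Vec (Fin k) n → A) f →
               run (queryAll xs c) f ≡ c (Vec.map f xs)
run-queryAll []       c f = refl
run-queryAll (x ∷ xs) c f = run-queryAll xs (c ∘ (f x ∷_)) f

-- The reduction and its correctness.

module _ (m n : ℕ) where
  private
    k = m * n
    R = splitRing m k

  open Ring R using (Carrier; _+_) renaming (_*_ to _·_)
  open Inverse (splitRing↔word m k) renaming (to to encode; from to decode)

  -- Ring and polynomial depend on m and n alone, so only generators need queries, namely those to
  -- one block.
  splitProcedures : Procedures m k (k * (m * m)) n
  splitProcedures = record
    { addProc       = λ u v → return (encode (decode u + decode v))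
    ; mulProc       = λ u v → return (encode (decode u · decode v))
    ; generatorProc = λ x → let i = quotient {m} n x in
                        queryAll (tabulate (combine i)) (encode ∘ blockElement m k i)
    ; polyProc      = λ us → return
                        (encode (evalPolynomial R (splitPolynomial m k) (Vec.map decode us)))
    }

  module _ (f : Fin k → Fin k) where
    splitGenerator : Fin k → Carrier
    splitGenerator x = blockElement m k i (block f i)
      where i = quotient {m} n x

    splitInstance : MITInstance m k (k * (m * m))
    splitInstance = identityTesting R (splitRing↔word m k) splitGenerator (splitPolynomial m k)

    splitInstance-implements : Implements splitProcedures f splitInstance
    splitInstance-implements = record
      { add-answers       = λ _ _ → refl
      ; mul-answers       = λ _ _ → refl
      ; generator-answers = λ x → run-queryAll (tabulate (combine (quotient {m} n x))) _ f
      ; poly-answers      = λ _ → refl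
      }

    -- At a collision j, substituting for each xₜ a generator from block t gives every column sum
    -- the value 1, so component j of P is J. The argument in `Fin m` selects an entry of J to
    -- contradict the identity.
    identity⇒noSplitCollision : Fin m → MITInstance.IsIdentity splitInstance →
                                ¬ HasSplitCollision m n f
    identity⇒noSplitCollision p isId collision =
      subst T (trans (sym (evalSplitPolynomial m k a j p p)) (isId a a∈span j p p))
        (all⁻ (λ t → columnSum m k (lookup a t) j t) {allFin m}
          (All.tabulate λ {t} _ → Equivalence.from T-≡ (columnSum≡true t)))
      where
      j,once = Equivalence.to (splitCollision⇔ f) collision
      j      = proj₁ j,once
      once   = proj₂ j,once
      point : Fin m → Fin k
      -- Any point of block t would do; the remainder of `j` serves as an element of `Fin n`.
      point t = combine t (remainder {m} n j)
      a : Vec Carrier m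
      a = tabulate (splitGenerator ∘ point)
      a∈span : ∀ t → InAdditiveSpan R splitGenerator (lookup a t)
      a∈span t = subst (InAdditiveSpan R splitGenerator) (sym (Vec.lookup∘tabulate _ t))
        (generator∈span R splitGenerator (point t))
      columnSum≡true : ∀ t → columnSum m k (lookup a t) j t ≡ true
      columnSum≡true t = trans
        (cong (λ x → columnSum m k x j t) (trans (Vec.lookup∘tabulate _ t)
          (cong (λ (i , _) → blockElement m k i (block f i)) (remQuot-combine t (remainder {m} n j)))))
        (columnSum-blockElement m k t (block f t) j (once t))

    -- Each component j has a block t where j is not hit exactly once. Column t then vanishes on all
    -- generators, hence on T, and its sum is a zero factor of P.
    noSplitCollision⇒identity : ¬ HasSplitCollision m n f → MITInstance.IsIdentity splitInstance
    noSplitCollision⇒identity noCollision a a∈span j p q =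
      trans (evalSplitPolynomial m k a j p q) (¬-not λ all≡true →
        contradiction
          (trans (sym columnSum≡false)
            (Equivalence.to T-≡
              (All.lookup (all⁺ _ (allFin m) (Equivalence.from T-≡ all≡true)) (∈-allFin t))))
          λ ())
      where
      missed : ∃[ t ] multiplicity f j t ≢ 1
      -- Equality of numbers is decidable and there are finitely many blocks, so a failing block is
      -- found constructively.
      missed = ¬∀⟶∃¬ m _ (λ t → multiplicity f j t ℕ.≟ 1) λ once →
        noCollision (Equivalence.from (splitCollision⇔ f) (j , once))
      t   = proj₁ missed
      columnSum≡false : columnSum m k (lookup a t) j t ≡ false
      columnSum≡false = sum-zero (Ring.+-commutativeMonoid 𝔽₂) _
        (span-zeroColumn m k j t splitGenerator
          (λ x → blockElement-zeroColumn m k _ (block f (quotient {m} n x)) j t λ eq once →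
            proj₂ missed (subst (λ i → multiplicity f j i ≡ 1) eq once))
          (a∈span t))

theorem4p1 : (m n : ℕ) .{{_ : NonZero m}} →
    ∃[ ℓ ] Σ[ procs ∈ Procedures m (m * n) ℓ n ]
    ((f : Fin (m * n) → Fin (m * n)) →
    Σ[ I ∈ MITInstance m (m * n) ℓ ]
    (Implements procs f I ×
    (MITInstance.IsIdentity I ⇔ (¬ HasSplitCollision m n f))))
theorem4p1 m n =
  _ , splitProcedures m n , λ f →
  splitInstance m n f , splitInstance-implements m n f ,
  -- Since m is nonzero, 0 is a valid matrix index.
  mk⇔ (identity⇒noSplitCollision m n f (fromℕ< (>-nonZero⁻¹ m))) (noSplitCollision⇒identity m n f)
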